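{- For every integer $k\ge 2$ there exists a $(k+1)$-pass catalytic streaming algorithm which takes as input a stream $\mathcal S=\langle x_1,\dots,x_m\rangle$ with items in $[n]$ and outputs the exact value of $F_k(\mathcal S)=\sum_{i=1}^n f_i^k$, using $O(k\log (mk))$ bits of clean space and $O(kn\log (mk))$ bits of catalytic space.
   Context: A stream is a sequence $\mathcal S=\langle x_1,\dots,x_m\rangle$ with $x_i\in[n]=\{1,\dots,n\}$; $f_i$ is the number of occurrences of $i$ in the stream. The length $m$ is known to the algorithm in advance and $m\ge n$. Catalytic streaming model: an algorithm has read-only access to the stream, which it scans sequentially from beginning to end in each pass; a workspace ("clean space") initialized to all zeros; and a catalytic memory initially containing an arbitrary string $z$. The algorithm may read and modify the catalytic memory during the computation but must restore it to exactly $z$ at the end. It computes a function $g$ if for every stream $\mathcal S$ and every initial catalytic content $z$ it outputs $g(\mathcal S)$ and terminates with catalytic content exactly $z$. Clean space and catalytic space are measured in bits. Space complexity refers to storage space (memory maintained between arrivals of consecutive stream items), not to the temporary memory used while processing a single item. -}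

module Defs where

open import Data.Bool.Base using (Bool; false)
open import Data.Fin.Base using (Fin)
open import Data.Fin.Properties using (_≟_)
open import Data.Nat.Base using (ℕ; _^_)
open import Data.Nat.GeneralisedArithmetic using (iterate)
open import Data.Product.Base using (_×_; _,_; proj₂)
open import Data.Vec.Base using (Vec; count; foldl′; replicate; sum; tabulate)
open import Relation.Binary.PropositionalEquality.Core using (_≡_)

-- Items 1, …, n are represented by Fin n.
Stream : ℕ → ℕ → Set
Stream n m = Vec (Fin n) m

frequency : ∀ {n m} → Stream n m → Fin n → ℕ
frequency S i = count (_≟ i) S

F : ∀ {n m} → ℕ → Stream n m → ℕ
F k S = sum (tabulate λ i → frequency S i ^ k)

-- Only the memory kept between consecutive items is charged, so the work done
-- on one item, or at either end of a pass, is an arbitrary function of the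
-- memory contents.  None of these functions is told the number of the current
-- pass or the position in the stream: an algorithm that needs them has to keep
-- them in its memory.
record CatalyticStreamingAlgorithm (passes n : ℕ) (Output : Set) : Set where
  field
    cleanBits     : ℕ
    catalyticBits : ℕ

  CleanMemory : Set
  CleanMemory = Vec Bool cleanBits

  CatalyticMemory : Set
  CatalyticMemory = Vec Bool catalyticBits

  Memory : Set
  Memory = CleanMemory × CatalyticMemory

  field
    startPass : Memory → Memory
    readItem  : Memory → Fin n → Memory
    endPass   : Memory → Memory
    output    : Memory → Output

  runPass : ∀ {m} → Stream n m → Memory → Memory
  runPass S μ = endPass (foldl′ readItem (startPass μ) S)

  run : ∀ {m} → Stream n m → CatalyticMemory → Memory
  run S z = iterate (runPass S) (replicate cleanBits false , z) passes

  Computes : ∀ {m} → (Stream n m → Output) → Set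
  Computes {m} g = (S : Stream n m) (z : CatalyticMemory) →
    output (run S z) ≡ g S × proj₂ (run S z) ≡ z

{-# OPTIONS --safe #-}

-- Treat the catalytic memory as n registers modulo 2^b with arbitrary initial
-- contents z i.  Each of the first k passes adds f i to the i-th register, so
-- before pass j = 0, …, k the power sum G j = Σᵢ (z i + j f i)^k can be measured.
-- The k-th finite difference Σⱼ (-1)^(k-j) (k choose j) G j equals k! Σᵢ (f i)^k
-- whatever z is, and is accumulated modulo 2^b in clean memory; b is chosen so
-- that k! F k < 2^b.  The last pass subtracts k f i and thereby restores z.
module Submission where

open import Defs
open import Data.Bool.Base using (Bool; true; false; if_then_else_; T)
open import Data.Fin.Base using (Fin; zero; suc; toℕ; fromℕ<; combine; remQuot)
open import Data.Fin.Properties using (_≟_; 2↔Bool; toℕ-combine; toℕ-fromℕ<; toℕ<n; toℕ-injective; remQuot-combine; combine-remQuot)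
open import Data.Integer.Base using (ℤ; +_; ∣_∣; 0ℤ; 1ℤ)
open import Data.Nat.Base using (ℕ; zero; suc; _!; NonZero)
open import Data.Nat.GeneralisedArithmetic using (iterate)
open import Data.Product.Base using (_×_; proj₁; proj₂; _,_)
open import Data.Vec.Base using (Vec; []; _∷_; foldl′; lookup; replicate; tabulate)
open import Data.Vec.Properties using (lookup∘tabulate; tabulate∘lookup; tabulate-cong; lookup-replicate; count≤n)
open import Function.Base using (_∘_)
open import Function.Bundles using (Inverse)
open import Relation.Binary.PropositionalEquality using (_≡_; refl; sym; trans; cong; cong₂; subst; module ≡-Reasoning)
open import Relation.Nullary using (does; contradiction)
import Data.Integer.Base as ℤ
import Data.Integer.Properties as ℤ
import Data.Nat.Base as ℕ
import Data.Nat.Properties as ℕ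
import Data.Vec.Base as Vec
open import Algebra.Properties.Semiring.Sum ℤ.+-*-semiring using (sum; sum-cong-≗; *-distribˡ-sum)

-- Iterated finite differences of powers of linear functions.

module FiniteDifference where

  open import Data.Integer.Base using (_+_; _*_; _-_; -_; _^_)
  open import Data.Integer.Tactic.RingSolver using (solve-∀)

  Δ^ : ℕ → (ℕ → ℤ) → ℕ → ℤ
  Δ^ zero    g j = g j
  Δ^ (suc n) g j = Δ^ n g (suc j) - Δ^ n g j

  Δ^-shift : ∀ n g j → Δ^ n (g ∘ suc) j ≡ Δ^ n g (suc j)
  Δ^-shift zero    g j = refl
  Δ^-shift (suc n) g j = cong₂ _-_ (Δ^-shift n g (suc j)) (Δ^-shift n g j)

  Δ^-const : ∀ n c j → Δ^ (suc n) (λ _ → c) j ≡ 0ℤ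
  Δ^-const zero    c j = ℤ.+-inverseʳ c
  Δ^-const (suc n) c j = cong₂ _-_ (Δ^-const n c (suc j)) (Δ^-const n c j)

  sum-minus : ∀ {n} (a b : Fin n → ℤ) → sum (λ i → a i - b i) ≡ sum a - sum b
  sum-minus {zero}  a b = refl
  sum-minus {suc n} a b =
    trans (cong (_+_ (a zero - b zero)) (sum-minus (a ∘ suc) (b ∘ suc)))
          (rearrange (a zero) (b zero) (sum (a ∘ suc)) (sum (b ∘ suc)))
    where
    rearrange : ∀ p q r s → (p - q) + (r - s) ≡ (p + r) - (q + s)
    rearrange = solve-∀

  pos-^ : ∀ f j → + (f ℕ.^ j) ≡ (+ f) ^ j
  pos-^ f zero    = refl
  pos-^ f (suc j) = trans (ℤ.pos-* f (f ℕ.^ j)) (cong (+ f *_) (pos-^ f j))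

  pos-sum : ∀ {n} (h : Fin n → ℕ) → + Vec.sum (tabulate h) ≡ sum (λ i → + h i)
  pos-sum {zero}  h = refl
  pos-sum {suc n} h = cong (_+_ (+ h zero)) (pos-sum (h ∘ suc))

  -- Linearity, which lets each register be analysed on its own.
  Δ^-sum : ∀ k {n} (g : Fin n → ℕ → ℤ) j →
    Δ^ k (λ t → sum λ i → g i t) j ≡ sum (λ i → Δ^ k (g i) j)
  Δ^-sum zero    g j = refl
  Δ^-sum (suc k) g j = trans (cong₂ _-_ (Δ^-sum k g (suc j)) (Δ^-sum k g j))
    (sym (sum-minus (λ i → Δ^ k (g i) (suc j)) (λ i → Δ^ k (g i) j)))

  line : ℤ → ℤ → ℕ → ℤ
  line z f j = z + + j * f

  line-suc : ∀ z f j → line z f (suc j) ≡ line z f j + f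
  line-suc z f j = rearrange z f (+ j)
    where
    rearrange : ∀ z f x → z + (1ℤ + x) * f ≡ (z + x * f) + f
    rearrange = solve-∀

  -- The discrete Leibniz rule with a linear factor: the first difference of `line z f` is the
  -- constant `f` and all higher ones vanish, so only two terms survive.
  Δ^-line-* : ∀ z f n g j → Δ^ (suc n) (λ t → line z f t * g t) j ≡
    line z f j * Δ^ (suc n) g j + + suc n * f * Δ^ n g (suc j)
  Δ^-line-* z f zero    g j rewrite line-suc z f j =
    rearrange (line z f j) f (g (suc j)) (g j)
    where
    rearrange : ∀ u f x y → (u + f) * x - u * y ≡ u * (x - y) + 1ℤ * f * x
    rearrange = solve-∀
  Δ^-line-* z f (suc n) g j
    rewrite Δ^-line-* z f n g (suc j) | Δ^-line-* z f n g j | line-suc z f j =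
    rearrange (line z f j) f (+ suc n)
      (Δ^ n g (suc (suc j))) (Δ^ n g (suc j)) (Δ^ n g j)
    where
    rearrange : ∀ u f p a b c →
      ((u + f) * (a - b) + p * f * a) - (u * (b - c) + p * f * b) ≡
      u * ((a - b) - (b - c)) + (1ℤ + p) * f * (a - b)
    rearrange = solve-∀

  -- A polynomial of degree `k` is killed by more than `k` differences. Splitting off one linear
  -- factor by the Leibniz rule leaves differences of the lower power whose orders still exceed its
  -- degree.
  Δ^-power-vanishes : ∀ z f k n j → k ℕ.< n → Δ^ n (λ t → line z f t ^ k) j ≡ 0ℤ
  Δ^-power-vanishes z f zero    (suc n) j _ = Δ^-const n 1ℤ j
  Δ^-power-vanishes z f (suc k) (suc n) j (ℕ.s≤s k<n) = begin
    Δ^ (suc n) (λ t → line z f t * power t) j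
      ≡⟨ Δ^-line-* z f n power j ⟩
    line z f j * Δ^ (suc n) power j + + suc n * f * Δ^ n power (suc j)
      ≡⟨ cong₂ (λ x y → line z f j * x + + suc n * f * y)
           (Δ^-power-vanishes z f k (suc n) j (ℕ.m<n⇒m<1+n k<n))
           (Δ^-power-vanishes z f k n (suc j) k<n) ⟩
    line z f j * 0ℤ + + suc n * f * 0ℤ
      ≡⟨ cong₂ _+_ (ℤ.*-zeroʳ (line z f j)) (ℤ.*-zeroʳ (+ suc n * f)) ⟩
    0ℤ ∎
    where
    open ≡-Reasoning
    power : ℕ → ℤ
    power t = line z f t ^ k

  -- Of the two Leibniz terms the first vanishes by degree, and the second contributes a factor
  -- `suc k * f` at each induction step. The unknown initial content `z` drops out.
  Δ^-power : ∀ z f k j → Δ^ k (λ t → line z f t ^ k) j ≡ + (k !) * f ^ k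
  Δ^-power z f zero    j = refl
  Δ^-power z f (suc k) j = begin
    Δ^ (suc k) (λ t → line z f t * power t) j
      ≡⟨ Δ^-line-* z f k power j ⟩
    line z f j * Δ^ (suc k) power j + + suc k * f * Δ^ k power (suc j)
      ≡⟨ cong₂ (λ x y → line z f j * x + + suc k * f * y)
           (Δ^-power-vanishes z f k (suc k) j (ℕ.n<1+n k))
           (Δ^-power z f k (suc j)) ⟩
    line z f j * 0ℤ + + suc k * f * (+ (k !) * f ^ k)
      ≡⟨ rearrange (line z f j) (+ suc k) f (+ (k !)) (f ^ k) ⟩
    + suc k * + (k !) * (f * f ^ k)
      ≡⟨ cong (_* (f * f ^ k)) (ℤ.pos-* (suc k) (k !)) ⟨
    + (suc k !) * f ^ suc k ∎
    where
    open ≡-Reasoning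
    power : ℕ → ℤ
    power t = line z f t ^ k
    rearrange : ∀ u p f q x → u * 0ℤ + p * f * (q * x) ≡ p * q * (f * x)
    rearrange = solve-∀

  -- weight k j = (-1)^(k-j) (k choose j)
  weight : ℕ → ℕ → ℤ
  weight zero    zero    = 1ℤ
  weight zero    (suc j) = 0ℤ
  weight (suc k) zero    = - weight k zero
  weight (suc k) (suc j) = weight k j - weight k (suc j)

  weight-vanishes : ∀ k j → k ℕ.< j → weight k j ≡ 0ℤ
  weight-vanishes zero    (suc j) _ = refl
  weight-vanishes (suc k) (suc j) (ℕ.s≤s k<j) =
    cong₂ _-_ (weight-vanishes k j k<j) (weight-vanishes k (suc j) (ℕ.m<n⇒m<1+n k<j))

  weightedSum : (ℕ → ℤ) → (ℕ → ℤ) → ℕ → ℤ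
  weightedSum w g zero    = 0ℤ
  weightedSum w g (suc t) = weightedSum w g t + w t * g t

  -- Agreement is asked for below `N` only, because the register offsets grow linearly only up to
  -- `k`.
  weightedSum-cong : ∀ w {g h} N → (∀ t → t ℕ.< N → g t ≡ h t) →
    weightedSum w g N ≡ weightedSum w h N
  weightedSum-cong w zero    g≗h = refl
  weightedSum-cong w (suc N) g≗h = cong₂ (λ x y → x + w N * y)
    (weightedSum-cong w N λ t t<N → g≗h t (ℕ.m<n⇒m<1+n t<N))
    (g≗h N (ℕ.n<1+n N))

  -- The Pascal recursion of `weight`, summed over the index; the shifted sum has one term fewer.
  weightedSum-weight-suc : ∀ k g N → weightedSum (weight (suc k)) g (suc N) ≡
    weightedSum (weight k) (g ∘ suc) N - weightedSum (weight k) g (suc N)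
  weightedSum-weight-suc k g zero = rearrange (weight k 0) (g 0)
    where
    rearrange : ∀ w x → 0ℤ + (- w) * x ≡ 0ℤ - (0ℤ + w * x)
    rearrange = solve-∀
  weightedSum-weight-suc k g (suc N) rewrite weightedSum-weight-suc k g N =
    rearrange (weightedSum (weight k) (g ∘ suc) N) (weightedSum (weight k) g (suc N))
      (weight k N) (weight k (suc N)) (g (suc N))
    where
    rearrange : ∀ a b v w x → (a - b) + (v - w) * x ≡ (a + v * x) - (b + w * x)
    rearrange = solve-∀

  Δ^-weightedSum : ∀ k g → weightedSum (weight k) g (suc k) ≡ Δ^ k g 0
  Δ^-weightedSum zero    g = trans (ℤ.+-identityˡ _) (ℤ.*-identityˡ (g 0))
  Δ^-weightedSum (suc k) g = begin
    weightedSum (weight (suc k)) g (suc (suc k))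
      ≡⟨ weightedSum-weight-suc k g (suc k) ⟩
    weightedSum (weight k) (g ∘ suc) (suc k)
      - (weightedSum (weight k) g (suc k) + weight k (suc k) * g (suc k))
      ≡⟨ cong₂ _-_ (Δ^-weightedSum k (g ∘ suc))
           -- The unshifted sum runs one index too far for the induction hypothesis; its extra term
           -- has weight zero.
           (cong₂ (λ x w → x + w * g (suc k)) (Δ^-weightedSum k g)
             (weight-vanishes k (suc k) (ℕ.n<1+n k))) ⟩
    Δ^ k (g ∘ suc) 0 - (Δ^ k g 0 + 0ℤ * g (suc k))
      ≡⟨ cong₂ _-_ (Δ^-shift k g 0) (ℤ.+-identityʳ (Δ^ k g 0)) ⟩
    Δ^ (suc k) g 0 ∎
    where open ≡-Reasoning

-- Congruence of integers modulo `M` and canonical residues.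

module Congruence (M : ℕ) .{{_ : NonZero M}} where

  open import Data.Integer.Base using (_+_; _*_; _-_; -_; _^_; _%ℕ_; _/ℕ_)
  open import Data.Integer.DivMod using (n%ℕd<d; a≡a%ℕn+[a/ℕn]*n)
  open import Data.Integer.Divisibility.Signed using (_∣_; divides; ∣⇒∣ᵤ; ∣m∣n⇒∣m+n; ∣m⇒∣-m; ∣n⇒∣m*n; ∣m⇒∣m*n)
  open import Data.Integer.Tactic.RingSolver using (solve-∀)
  open import Data.Nat.Divisibility using (n∣m⇒m%n≡0)
  open import Data.Nat.DivMod using (m<n⇒m%n≡m)

  infix 4 _≈_

  -- A record instead of the bare divisibility, so that unification can recover `x` and `y`, which
  -- the difference `x - y` does not determine.
  record _≈_ (x y : ℤ) : Set where
    constructor congruent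
    field difference : + M ∣ x - y

  ≈-reflexive : ∀ {x y} → x ≡ y → x ≈ y
  ≈-reflexive {x} refl = congruent (divides 0ℤ (ℤ.+-inverseʳ x))

  ≈-refl : ∀ x → x ≈ x
  ≈-refl x = ≈-reflexive refl

  +-cong : ∀ {x x′ y y′} → x ≈ x′ → y ≈ y′ → x + y ≈ x′ + y′
  +-cong {x} {x′} {y} {y′} (congruent p) (congruent q) =
    congruent (subst (+ M ∣_) (rearrange x x′ y y′) (∣m∣n⇒∣m+n p q))
    where
    rearrange : ∀ x x′ y y′ → (x - x′) + (y - y′) ≡ (x + y) - (x′ + y′)
    rearrange = solve-∀

  *-cong : ∀ {x x′ y y′} → x ≈ x′ → y ≈ y′ → x * y ≈ x′ * y′
  *-cong {x} {x′} {y} {y′} (congruent p) (congruent q) = congruent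
    (subst (+ M ∣_) (rearrange x x′ y y′) (∣m∣n⇒∣m+n (∣m⇒∣m*n y p) (∣n⇒∣m*n x′ q)))
    where
    rearrange : ∀ x x′ y y′ → (x - x′) * y + x′ * (y - y′) ≡ x * y - x′ * y′
    rearrange = solve-∀

  ^-cong : ∀ {x y} k → x ≈ y → x ^ k ≈ y ^ k
  ^-cong zero    p = ≈-reflexive refl
  ^-cong (suc k) p = *-cong p (^-cong k p)

  sum-cong : ∀ {n} {a b : Fin n → ℤ} → (∀ i → a i ≈ b i) → sum a ≈ sum b
  sum-cong {zero}  p = ≈-reflexive refl
  sum-cong {suc n} p = +-cong (p zero) (sum-cong (p ∘ suc))

  residue : ℤ → Fin M
  residue x = fromℕ< (n%ℕd<d x M)

  toℕ-residue : ∀ x → toℕ (residue x) ≡ x %ℕ M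
  toℕ-residue x = toℕ-fromℕ< (n%ℕd<d x M)

  residue-≈ : ∀ x → + toℕ (residue x) ≈ x
  residue-≈ x rewrite toℕ-residue x = congruent (divides (- (x /ℕ M)) (begin
    + (x %ℕ M) - x
      ≡⟨ cong (λ y → + (x %ℕ M) - y) (a≡a%ℕn+[a/ℕn]*n x M) ⟩
    + (x %ℕ M) - (+ (x %ℕ M) + x /ℕ M * + M)
      ≡⟨ rearrange (+ (x %ℕ M)) (x /ℕ M) (+ M) ⟩
    - (x /ℕ M) * + M ∎))
    where
    open ≡-Reasoning
    rearrange : ∀ r q m → r - (r + q * m) ≡ - q * m
    rearrange = solve-∀

  -- Two numbers in the range from 0 to `M - 1` differ by less than `M` in absolute value, and the
  -- only such multiple of `M` is zero.
  ≈⇒≡ : ∀ {r s : Fin M} → + toℕ r ≈ + toℕ s → r ≡ s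
  ≈⇒≡ {r} {s} (congruent p) = toℕ-injective (ℤ.+-injective (ℤ.i-j≡0⇒i≡j _ _ (ℤ.∣i∣≡0⇒i≡0 (begin
    ∣ + toℕ r - + toℕ s ∣          ≡⟨ m<n⇒m%n≡m distance<M ⟨
    ∣ + toℕ r - + toℕ s ∣ ℕ.% M    ≡⟨ n∣m⇒m%n≡0 _ M (∣⇒∣ᵤ p) ⟩
    0                              ∎))))
    where
    open ≡-Reasoning
    distance<M : ∣ + toℕ r - + toℕ s ∣ ℕ.< M
    distance<M rewrite ℤ.m-n≡m⊖n (toℕ r) (toℕ s) =
      ℕ.≤-<-trans (ℤ.∣m⊝n∣≤m⊔n (toℕ r) (toℕ s)) (ℕ.⊔-lub (toℕ<n r) (toℕ<n s))

  residue-cong : ∀ {x y} → x ≈ y → residue x ≡ residue y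
  residue-cong {x} {y} (congruent p)
    with congruent x-residue ← residue-≈ x | congruent y-residue ← residue-≈ y =
    ≈⇒≡ (congruent (subst (+ M ∣_)
      (rearrange (+ toℕ (residue x)) x y (+ toℕ (residue y)))
      (∣m∣n⇒∣m+n (∣m∣n⇒∣m+n x-residue p) (∣m⇒∣-m y-residue))))
    where
    rearrange : ∀ a x y b → ((a - x) + (x - y)) + - (b - y) ≡ a - b
    rearrange = solve-∀

  residue-toℕ : ∀ r → residue (+ toℕ r) ≡ r
  residue-toℕ r = ≈⇒≡ (residue-≈ (+ toℕ r))

  toℕ-residue-small : ∀ {t} → t ℕ.< M → toℕ (residue (+ t)) ≡ t
  toℕ-residue-small {t} t<M = trans (toℕ-residue (+ t)) (m<n⇒m%n≡m t<M)

-- Binary coding of the numbers below a power of two, most significant bit first.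

module Bits where

  open import Data.Nat.Base using (_^_; _+_; _*_)
  open Inverse 2↔Bool using (to; from; strictlyInverseˡ; strictlyInverseʳ)

  toFin : ∀ {b} → Vec Bool b → Fin (2 ^ b)
  toFin []       = zero
  toFin (x ∷ xs) = combine (from x) (toFin xs)

  fromFin : ∀ b → Fin (2 ^ b) → Vec Bool b
  fromFin zero    _ = []
  fromFin (suc b) r = to (proj₁ (remQuot {2} (2 ^ b) r)) ∷ fromFin b (proj₂ (remQuot {2} (2 ^ b) r))

  fromFin∘toFin : ∀ {b} (xs : Vec Bool b) → fromFin b (toFin xs) ≡ xs
  fromFin∘toFin []               = refl
  fromFin∘toFin {suc b} (x ∷ xs) =
    trans (cong (λ (y , r) → to y ∷ fromFin b r) (remQuot-combine (from x) (toFin xs)))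
          (cong₂ _∷_ (strictlyInverseˡ x) (fromFin∘toFin xs))

  toFin∘fromFin : ∀ b (r : Fin (2 ^ b)) → toFin (fromFin b r) ≡ r
  toFin∘fromFin zero    zero = refl
  toFin∘fromFin (suc b) r    =
    trans (cong₂ combine (strictlyInverseʳ (proj₁ (remQuot {2} (2 ^ b) r)))
                         (toFin∘fromFin b (proj₂ (remQuot {2} (2 ^ b) r))))
          (combine-remQuot {2} (2 ^ b) r)

  toℕ-toFin-zeros : ∀ b → toℕ (toFin (replicate b false)) ≡ 0
  toℕ-toFin-zeros zero    = refl
  toℕ-toFin-zeros (suc b) = begin
    toℕ (combine {2} zero (toFin (replicate b false)))  ≡⟨ toℕ-combine {2} zero (toFin (replicate b false)) ⟩
    2 ^ b * 0 + toℕ (toFin (replicate b false))         ≡⟨ cong₂ _+_ (ℕ.*-zeroʳ (2 ^ b)) (toℕ-toFin-zeros b) ⟩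
    0                                                   ∎
    where open ≡-Reasoning

-- Arrays of `b`-bit registers packed into one bit vector.

module Registers (b : ℕ) where

  open import Data.Nat.Base using (_^_; _*_)
  open Bits
  open Congruence (2 ^ b) {{ℕ.m^n≢0 2 b}} public

  value : Vec Bool b → ℤ
  value r = + toℕ (toFin r)

  store : ℤ → Vec Bool b
  store x = fromFin b (residue x)

  store-cong : ∀ {x y} → x ≈ y → store x ≡ store y
  store-cong x≈y = cong (fromFin b) (residue-cong x≈y)

  value-store : ∀ x → value (store x) ≈ x
  value-store x = subst (λ r → + toℕ r ≈ x) (sym (toFin∘fromFin b (residue x))) (residue-≈ x)

  -- The modulus is exactly `2 ^ b`, so every bit pattern is the code of a residue. This makes exact
  -- restoration of arbitrary catalytic content possible.
  store-value : ∀ r → store (value r) ≡ r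
  store-value r = trans (cong (fromFin b) (residue-toℕ (toFin r))) (fromFin∘toFin r)

  value-store-small : ∀ {t} → t ℕ.< 2 ^ b → value (store (+ t)) ≡ + t
  value-store-small {t} t<2^b =
    cong +_ (trans (cong toℕ (toFin∘fromFin b (residue (+ t)))) (toℕ-residue-small t<2^b))

  store-zero : store 0ℤ ≡ replicate b false
  store-zero = trans (cong (store ∘ +_) (sym (toℕ-toFin-zeros b))) (store-value (replicate b false))

  cell : ∀ {n} → Vec Bool (n * b) → Fin n → Vec Bool b
  cell v i = tabulate λ l → lookup v (combine i l)

  fromCells : ∀ n → (Fin n → Vec Bool b) → Vec Bool (n * b)
  fromCells n c = tabulate λ j → lookup (c (proj₁ (remQuot {n} b j))) (proj₂ (remQuot {n} b j))

  fromCells-cong : ∀ n {c d} → (∀ i → c i ≡ d i) → fromCells n c ≡ fromCells n d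
  fromCells-cong n c≗d = tabulate-cong λ j →
    cong (λ r → lookup r (proj₂ (remQuot {n} b j))) (c≗d (proj₁ (remQuot {n} b j)))

  cell-fromCells : ∀ n c i → cell (fromCells n c) i ≡ c i
  cell-fromCells n c i = trans (tabulate-cong pointwise) (tabulate∘lookup (c i))
    where
    pointwise : ∀ l → lookup (fromCells n c) (combine i l) ≡ lookup (c i) l
    pointwise l = trans (lookup∘tabulate _ (combine i l))
      (cong (λ (i , l) → lookup (c i) l) (remQuot-combine i l))

  fromCells-cell : ∀ n v → fromCells n (cell v) ≡ v
  fromCells-cell n v = trans (tabulate-cong pointwise) (tabulate∘lookup v)
    where
    pointwise : ∀ j → lookup (cell v (proj₁ (remQuot {n} b j))) (proj₂ (remQuot {n} b j)) ≡ lookup v j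
    pointwise j = trans (lookup∘tabulate _ (proj₂ (remQuot {n} b j)))
      (cong (lookup v) (combine-remQuot {n} b j))

  fromCells-zeros : ∀ n → fromCells n (λ _ → replicate b false) ≡ replicate (n * b) false
  fromCells-zeros n = trans (tabulate-cong pointwise) (tabulate∘lookup (replicate (n * b) false))
    where
    pointwise : ∀ j → lookup (replicate b false) (proj₂ (remQuot {n} b j)) ≡ lookup (replicate (n * b) false) j
    pointwise j = trans (lookup-replicate (proj₂ (remQuot {n} b j)) false)
      (sym (lookup-replicate j false))

  -- Beyond this block the memory layout is hidden; registers are known only through the laws proved
  -- here.
  abstract

    readAll : ∀ {n} → Vec Bool (n * b) → Fin n → ℤ
    readAll v i = value (cell v i)

    writeAll : ∀ {n} → (Fin n → ℤ) → Vec Bool (n * b)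
    writeAll {n} R = fromCells n (store ∘ R)

    writeAll-cong : ∀ {n} {R R′ : Fin n → ℤ} → (∀ i → R i ≈ R′ i) → writeAll R ≡ writeAll R′
    writeAll-cong {n} R≈R′ = fromCells-cong n (store-cong ∘ R≈R′)

    readAll-writeAll : ∀ {n} (R : Fin n → ℤ) i → readAll (writeAll R) i ≈ R i
    readAll-writeAll {n} R i =
      subst (λ r → value r ≈ R i) (sym (cell-fromCells n (store ∘ R) i)) (value-store (R i))

    readAll-writeAll-small : ∀ {n} (R : Fin n → ℤ) i {t} → R i ≡ + t → t ℕ.< 2 ^ b →
      readAll (writeAll R) i ≡ + t
    readAll-writeAll-small {n} R i {t} eq t<2^b = begin
      value (cell (writeAll R) i)  ≡⟨ cong value (cell-fromCells n (store ∘ R) i) ⟩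
      value (store (R i))          ≡⟨ cong (value ∘ store) eq ⟩
      value (store (+ t))          ≡⟨ value-store-small t<2^b ⟩
      + t                          ∎
      where open ≡-Reasoning

    writeAll-readAll : ∀ {n} (v : Vec Bool (n * b)) → writeAll {n} (readAll v) ≡ v
    writeAll-readAll {n} v = trans (fromCells-cong n (store-value ∘ cell v)) (fromCells-cell n v)

    writeAll-zeros : ∀ {n} → writeAll {n} (λ _ → 0ℤ) ≡ replicate (n * b) false
    writeAll-zeros {n} = trans (fromCells-cong n (λ _ → store-zero)) (fromCells-zeros n)

-- The step is assumed for `t < N` only, since a pass is understood only while its number fits into
-- the counter.
iterate-trajectory : ∀ {A : Set} (f : A → A) (s : ℕ → A) N →
  (∀ t → t ℕ.< N → f (s t) ≡ s (suc t)) → iterate f (s 0) N ≡ s N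
iterate-trajectory f s zero    h = refl
iterate-trajectory f s (suc N) h = trans (cong (λ x → iterate f x N) (h 0 ℕ.z<s))
  (iterate-trajectory f (s ∘ suc) N λ t t<N → h (suc t) (ℕ.s<s t<N))

-- The algorithm with registers of width `b`, and its correctness when `b` is large enough.

module PowerSumAlgorithm (n k b : ℕ) where

  open import Data.Integer.Base using (_+_; _*_; _-_; _^_)
  open import Data.Integer.Tactic.RingSolver using (solve-∀)
  open import Data.Nat.DivMod using (m*n/n≡m)
  open FiniteDifference
  open Registers b
  open ≡-Reasoning

  instance
    k!≢0 : NonZero (k !)
    k!≢0 = k ℕ.!≢0

  -- Before pass j the i-th register is shifted by offset j * f i; the last
  -- pass brings the offset from k back to 0.
  offset : ℕ → ℤ
  offset t = if t ℕ.≤ᵇ k then + t else 0ℤ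

  offset-≤ : ∀ t → t ℕ.≤ k → offset t ≡ + t
  offset-≤ t t≤k with t ℕ.≤ᵇ k | ℕ.≤⇒≤ᵇ t≤k
  ... | true | _ = refl

  offset-suc-k : offset (suc k) ≡ 0ℤ
  offset-suc-k with suc k ℕ.≤ᵇ k in eq
  ... | true  = contradiction (ℕ.≤ᵇ⇒≤ (suc k) k (subst T (sym eq) _)) ℕ.1+n≰n
  ... | false = refl

  -- Equal to `1` in the passes before pass `k` and to `- k` in pass `k`.
  step : ℕ → ℤ
  step t = offset (suc t) - offset t

  indicator : Fin n → Fin n → ℤ
  indicator x i = if does (x ≟ i) then 1ℤ else 0ℤ

  -- An idealised memory with unbounded numbers. Correctness is argued here and transferred to bit
  -- vectors by `encode`.
  record State : Set where
    constructor state
    field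
      counter     : ℕ
      accumulator : ℤ
      registers   : Fin n → ℤ

  infix 4 _≋_

  -- The counter has to agree exactly because `weight` and `step` are evaluated at it; the other
  -- components may wrap around modulo `2 ^ b`.
  record _≋_ (s t : State) : Set where
    constructor agree
    open State
    field
      counter-≡     : counter s ≡ counter t
      accumulator-≈ : accumulator s ≈ accumulator t
      registers-≈   : ∀ i → registers s i ≈ registers t i

  Memory : Set
  Memory = Vec Bool (2 ℕ.* b) × Vec Bool (n ℕ.* b)

  cleanCells : ℕ → ℤ → Fin 2 → ℤ
  cleanCells t a zero    = + t
  cleanCells t a (suc _) = a

  encode : State → Memory
  encode (state t a R) = writeAll (cleanCells t a) , writeAll R

  decode : Memory → State
  decode (c , v) = state ∣ readAll {2} c zero ∣ (readAll {2} c (suc zero)) (readAll v)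

  -- Only residues are stored, so agreement modulo `2 ^ b` becomes equality of memories. Every
  -- decoding inside a pass is removed this way.
  encode-cong : ∀ {s t} → s ≋ t → encode s ≡ encode t
  encode-cong (agree refl a≈a′ R≈R′) = cong₂ _,_
    (writeAll-cong {R = cleanCells _ _} {cleanCells _ _} λ { zero → ≈-refl _ ; (suc _) → a≈a′ })
    (writeAll-cong R≈R′)

  decode-encode : ∀ s → State.counter s ℕ.< 2 ℕ.^ b → decode (encode s) ≋ s
  decode-encode (state t a R) t<2^b =
    agree (cong ∣_∣ (readAll-writeAll-small (cleanCells t a) zero refl t<2^b))
          (readAll-writeAll (cleanCells t a) (suc zero))
          (readAll-writeAll R)

  measure : State → State
  measure (state t a R) = state t (a + weight k t * sum (λ i → R i ^ k)) R

  bump : Fin n → State → State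
  bump x (state t a R) = state t a (λ i → R i + step t * indicator x i)

  tick : State → State
  tick (state t a R) = state (suc t) a R

  measure-cong : ∀ {s t} → s ≋ t → measure s ≋ measure t
  measure-cong {state t _ R} {state _ _ R′} (agree refl a≈a′ R≈R′) =
    agree refl
      (+-cong a≈a′ (*-cong (≈-refl (weight k t))
        (sum-cong {a = λ i → R i ^ k} {λ i → R′ i ^ k} λ i → ^-cong k (R≈R′ i))))
      R≈R′

  bump-cong : ∀ x {s t} → s ≋ t → bump x s ≋ bump x t
  bump-cong x {state t _ _} (agree refl a≈a′ R≈R′) =
    agree refl a≈a′ λ i → +-cong (R≈R′ i) (≈-refl (step t * indicator x i))

  tick-cong : ∀ {s t} → s ≋ t → tick s ≋ tick t
  tick-cong (agree refl a≈a′ R≈R′) = agree refl a≈a′ R≈R′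

  algorithm : CatalyticStreamingAlgorithm (suc k) n ℕ
  algorithm = record
    { cleanBits     = 2 ℕ.* b
    ; catalyticBits = n ℕ.* b
    -- The power sum is taken before any item is read, while all registers carry the same multiple
    -- of their frequencies.
    ; startPass     = encode ∘ measure ∘ decode
    ; readItem      = λ μ x → encode (bump x (decode μ))
    ; endPass       = encode ∘ tick ∘ decode
    ; output        = λ μ → ∣ State.accumulator (decode μ) ∣ ℕ./ (k !)
    }

  open CatalyticStreamingAlgorithm algorithm using (runPass; run; Computes)

  frequency-∷ : ∀ {m} x (S : Stream n m) i → + frequency (x ∷ S) i ≡ indicator x i + + frequency S i
  frequency-∷ x S i with does (x ≟ i)
  ... | true  = refl
  ... | false = refl

  -- The counter does not change within a pass, so each occurrence of `i` adds the same `step t` to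
  -- its register.
  foldl-bump : ∀ {m} (S : Stream n m) t a R → t ℕ.< 2 ℕ.^ b →
    foldl′ (λ μ x → encode (bump x (decode μ))) (encode (state t a R)) S ≡
    encode (state t a (λ i → R i + step t * + frequency S i))
  foldl-bump []      t a R t<2^b = encode-cong (agree refl (≈-refl _) λ i → ≈-reflexive (rearrange (R i) (step t)))
    where
    rearrange : ∀ r s → r ≡ r + s * 0ℤ
    rearrange = solve-∀
  foldl-bump (x ∷ S) t a R t<2^b = begin
    foldl′ _ (encode (bump x (decode (encode (state t a R))))) S
      ≡⟨ cong (λ μ → foldl′ _ μ S) (encode-cong (bump-cong x (decode-encode (state t a R) t<2^b))) ⟩
    foldl′ _ (encode (bump x (state t a R))) S
      ≡⟨ foldl-bump S t a _ t<2^b ⟩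
    encode (state t a (λ i → R i + step t * indicator x i + step t * + frequency S i))
      ≡⟨ encode-cong (agree refl (≈-refl _) λ i → ≈-reflexive (registers-eq i)) ⟩
    encode (state t a (λ i → R i + step t * + frequency (x ∷ S) i)) ∎
    where
    rearrange : ∀ r s p q → r + s * p + s * q ≡ r + s * (p + q)
    rearrange = solve-∀
    registers-eq : ∀ i → R i + step t * indicator x i + step t * + frequency S i ≡ R i + step t * + frequency (x ∷ S) i
    registers-eq i = trans (rearrange (R i) (step t) (indicator x i) (+ frequency S i))
      (cong (λ f → R i + step t * f) (sym (frequency-∷ x S i)))

  runPass-encode : ∀ {m} (S : Stream n m) t a R → t ℕ.< 2 ℕ.^ b →
    runPass S (encode (state t a R)) ≡
    encode (state (suc t) (a + weight k t * sum (λ i → R i ^ k)) (λ i → R i + step t * + frequency S i))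
  runPass-encode S t a R t<2^b = begin
    encode (tick (decode (foldl′ _ (encode (measure (decode (encode (state t a R))))) S)))
      ≡⟨ cong (λ μ → encode (tick (decode (foldl′ _ μ S))))
           (encode-cong (measure-cong (decode-encode (state t a R) t<2^b))) ⟩
    encode (tick (decode (foldl′ _ (encode (measure (state t a R))) S)))
      ≡⟨ cong (encode ∘ tick ∘ decode) (foldl-bump S t _ R t<2^b) ⟩
    encode (tick (decode (encode _)))
      ≡⟨ encode-cong (tick-cong (decode-encode _ t<2^b)) ⟩
    _ ∎

  module _ {m} (S : Stream n m) (z : Vec Bool (n ℕ.* b)) where

    shifted : ℕ → Fin n → ℤ
    shifted t i = readAll z i + offset t * + frequency S i

    measured : ℕ → ℤ
    measured t = sum λ i → shifted t i ^ k

    stateBefore : ℕ → State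
    stateBefore t = state t (weightedSum (weight k) measured t) (shifted t)

    runPass-stateBefore : ∀ t → t ℕ.< 2 ℕ.^ b →
      runPass S (encode (stateBefore t)) ≡ encode (stateBefore (suc t))
    runPass-stateBefore t t<2^b = trans (runPass-encode S t _ (shifted t) t<2^b)
      (encode-cong (agree refl (≈-refl _) λ i → ≈-reflexive
        (rearrange (readAll z i) (offset t) (offset (suc t)) (+ frequency S i))))
      where
      rearrange : ∀ z o o′ f → (z + o * f) + (o′ - o) * f ≡ z + o′ * f
      rearrange = solve-∀

    initial : (replicate (2 ℕ.* b) false , z) ≡ encode (stateBefore 0)
    initial = cong₂ _,_
      (sym (trans (writeAll-cong {2} {cleanCells 0 0ℤ} {λ _ → 0ℤ} λ { zero → ≈-refl 0ℤ ; (suc _) → ≈-refl 0ℤ }) (writeAll-zeros {2})))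
      (sym (trans (writeAll-cong λ i → ≈-reflexive (ℤ.+-identityʳ (readAll z i))) (writeAll-readAll z)))

    -- An exact identity in the integers: the weighted sum is a `k`-th difference, evaluated
    -- register by register. Reduction modulo `2 ^ b` enters only afterwards.
    accumulated : weightedSum (weight k) measured (suc k) ≡ + (k ! ℕ.* F k S)
    accumulated = begin
      weightedSum (weight k) measured (suc k)
        ≡⟨ weightedSum-cong (weight k) (suc k) (λ { t (ℕ.s≤s t≤k) → sum-cong-≗ λ i →
             cong (λ o → (readAll z i + o * + frequency S i) ^ k) (offset-≤ t t≤k) }) ⟩
      weightedSum (weight k) (λ t → sum λ i → power i t) (suc k)
        ≡⟨ Δ^-weightedSum k (λ t → sum λ i → power i t) ⟩
      Δ^ k (λ t → sum λ i → power i t) 0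
        ≡⟨ Δ^-sum k power 0 ⟩
      sum (λ i → Δ^ k (power i) 0)
        ≡⟨ sum-cong-≗ (λ i → trans (Δ^-power (readAll z i) (+ frequency S i) k 0)
             (cong (+ (k !) *_) (sym (pos-^ (frequency S i) k)))) ⟩
      sum (λ i → + (k !) * + (frequency S i ℕ.^ k))
        ≡⟨ *-distribˡ-sum (+ (k !)) (λ i → + (frequency S i ℕ.^ k)) ⟨
      + (k !) * sum (λ i → + (frequency S i ℕ.^ k))
        ≡⟨ cong (+ (k !) *_) (pos-sum (λ i → frequency S i ℕ.^ k)) ⟨
      + (k !) * + F k S
        ≡⟨ ℤ.pos-* (k !) (F k S) ⟨
      + (k ! ℕ.* F k S) ∎
      where
      power : Fin n → ℕ → ℤ
      power i t = line (readAll z i) (+ frequency S i) t ^ k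

    run-final : k ℕ.< 2 ℕ.^ b → run S z ≡ encode (stateBefore (suc k))
    run-final k<2^b = trans (cong (λ μ → iterate (runPass S) μ (suc k)) initial)
      (iterate-trajectory (runPass S) (encode ∘ stateBefore) (suc k)
        -- The passes start with counters `0` to `k`, all of which fit; the final value `suc k` may
        -- wrap around, but `output` looks at the accumulator alone.
        λ { t (ℕ.s≤s t≤k) → runPass-stateBefore t (ℕ.≤-<-trans t≤k k<2^b) })

  computes : ∀ {m} → k ℕ.< 2 ℕ.^ b → ((S : Stream n m) → k ! ℕ.* F k S ℕ.< 2 ℕ.^ b) → Computes {m} (F k)
  computes k<2^b bound S z rewrite run-final S z k<2^b =
    (begin
      ∣ readAll (writeAll (cleanCells (suc k) _)) (suc zero) ∣ ℕ./ (k !)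
        -- Being below `2 ^ b`, the true total is read back exactly and not just modulo `2 ^ b`.
        ≡⟨ cong (λ a → ∣ a ∣ ℕ./ (k !)) (readAll-writeAll-small (cleanCells (suc k) _) (suc zero) (accumulated S z) (bound S)) ⟩
      (k ! ℕ.* F k S) ℕ./ (k !)
        ≡⟨ cong (ℕ._/ (k !)) (ℕ.*-comm (k !) (F k S)) ⟩
      (F k S ℕ.* k !) ℕ./ (k !)
        ≡⟨ m*n/n≡m (F k S) (k !) ⟩
      F k S ∎) ,
    trans (writeAll-cong λ i → ≈-reflexive (trans
        (cong (λ o → readAll z i + o * + frequency S i) (offset-suc-k)) (ℤ.+-identityʳ (readAll z i))))
      (writeAll-readAll z)

-- Binary logarithms and the size of `k ! * F k S`.

open import Data.Nat.Base using (_+_; _*_; _^_; _≤_; _<_; z≤n; s≤s; ⌈_/2⌉; ⌊_/2⌋)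
open import Data.Nat.Induction using (<-rec)
open import Data.Nat.Logarithm using (⌈log₂_⌉; ⌈log₂⌉-mono-≤; ⌈log₂⌈n/2⌉⌉≡⌈log₂n⌉∸1)
open import Data.Nat.Tactic.RingSolver using (solve-∀)
open import Data.Product.Base using (Σ-syntax; ∃-syntax)

open CatalyticStreamingAlgorithm using (cleanBits; catalyticBits; Computes)

n≤2*⌈n/2⌉ : ∀ n → n ≤ 2 * ⌈ n /2⌉
n≤2*⌈n/2⌉ n = begin
  n                        ≡⟨ ℕ.⌊n/2⌋+⌈n/2⌉≡n n ⟨
  ⌊ n /2⌋ + ⌈ n /2⌉        ≤⟨ ℕ.+-monoˡ-≤ ⌈ n /2⌉ (ℕ.⌊n/2⌋≤⌈n/2⌉ n) ⟩
  ⌈ n /2⌉ + ⌈ n /2⌉        ≡⟨ cong (_+_ ⌈ n /2⌉) (ℕ.+-identityʳ ⌈ n /2⌉) ⟨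
  2 * ⌈ n /2⌉              ∎
  where open ℕ.≤-Reasoning

n≤2^⌈log₂n⌉ : ∀ n → n ≤ 2 ^ ⌈log₂ n ⌉
n≤2^⌈log₂n⌉ = <-rec _ λ
  { zero          rec → z≤n
  ; (suc zero)    rec → s≤s z≤n
  ; (suc (suc n)) rec → bound n (rec (ℕ.⌈n/2⌉<n n))
  }
  where
  open ℕ.≤-Reasoning
  bound : ∀ n (let N = suc (suc n)) → ⌈ N /2⌉ ≤ 2 ^ ⌈log₂ ⌈ N /2⌉ ⌉ → N ≤ 2 ^ ⌈log₂ N ⌉
  bound n ih = let N = suc (suc n) in begin
    N                              ≤⟨ n≤2*⌈n/2⌉ N ⟩
    2 * ⌈ N /2⌉                    ≤⟨ ℕ.*-monoʳ-≤ 2 ih ⟩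
    2 ^ suc ⌈log₂ ⌈ N /2⌉ ⌉        ≡⟨ cong (λ l → 2 ^ suc l) (⌈log₂⌈n/2⌉⌉≡⌈log₂n⌉∸1 N) ⟩
    2 ^ suc (⌈log₂ N ⌉ ℕ.∸ 1)      ≡⟨ cong (2 ^_) (ℕ.m+[n∸m]≡n (⌈log₂⌉-mono-≤ {2} {N} (s≤s (s≤s z≤n)))) ⟩
    2 ^ ⌈log₂ N ⌉                  ∎

*-^-distrib : ∀ x y n → (x * y) ^ n ≡ x ^ n * y ^ n
*-^-distrib x y zero    = refl
*-^-distrib x y (suc n) = trans (cong (x * y *_) (*-^-distrib x y n)) (rearrange x y (x ^ n) (y ^ n))
  where
  rearrange : ∀ x y a b → x * y * (a * b) ≡ x * a * (y * b)
  rearrange = solve-∀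

-- The base `c` is kept apart from `n` so that it stays fixed in the induction.
n!≤c^n : ∀ {c} n → n ≤ c → n ! ≤ c ^ n
n!≤c^n zero    _   = ℕ.≤-refl
n!≤c^n (suc n) n<c = ℕ.*-mono-≤ n<c (n!≤c^n n (ℕ.<⇒≤ n<c))

sum-tabulate-≤ : ∀ {n c} (h : Fin n → ℕ) → (∀ i → h i ≤ c) → Vec.sum (tabulate h) ≤ n * c
sum-tabulate-≤ {zero}  h h≤c = z≤n
sum-tabulate-≤ {suc n} h h≤c = ℕ.+-mono-≤ (h≤c zero) (sum-tabulate-≤ (h ∘ suc) (h≤c ∘ suc))

F≤n*m^k : ∀ {n m} k (S : Stream n m) → F k S ≤ n * m ^ k
F≤n*m^k k S = sum-tabulate-≤ _ λ i → ℕ.^-monoˡ-≤ k (count≤n (_≟ i) S)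

-- The factors `k ^ k` and `m ^ k` combine to `(m * k) ^ k`; the number `n` of items, at most `m`,
-- is absorbed by one more factor `m * k`.
k!*F≤[m*k]^[1+k] : ∀ {n m} k → 1 ≤ k → n ≤ m → (S : Stream n m) → k ! * F k S ≤ (m * k) ^ suc k
k!*F≤[m*k]^[1+k] {n} {m} k 1≤k n≤m S = begin
  k ! * F k S              ≤⟨ ℕ.*-mono-≤ (n!≤c^n k ℕ.≤-refl) (F≤n*m^k k S) ⟩
  k ^ k * (n * m ^ k)      ≤⟨ ℕ.*-monoʳ-≤ (k ^ k) (ℕ.*-monoˡ-≤ (m ^ k) (ℕ.≤-trans n≤m m≤m*k)) ⟩
  k ^ k * (m * k * m ^ k)  ≡⟨ rearrange (k ^ k) (m * k) (m ^ k) ⟩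
  m * k * (m ^ k * k ^ k)  ≡⟨ cong (m * k *_) (*-^-distrib m k k) ⟨
  (m * k) ^ suc k          ∎
  where
  open ℕ.≤-Reasoning
  m≤m*k : m ≤ m * k
  m≤m*k = ℕ.m≤m*n m k {{ℕ.>-nonZero 1≤k}}
  rearrange : ∀ a b c → a * (b * c) ≡ b * (c * a)
  rearrange = solve-∀

-- Choice of the register width and the resulting space bounds.

width : ℕ → ℕ → ℕ
width k m = ⌈log₂ m * k ⌉ * (2 + k)

-- The exponent `2 + k` in place of `1 + k` buys the strict inequality, as the base is at least 2.
[m*k]^[1+k]<2^width : ∀ k m → 2 ≤ m * k → (m * k) ^ suc k < 2 ^ width k m
[m*k]^[1+k]<2^width k m 2≤m*k = begin-strict
  (m * k) ^ suc k                  <⟨ ℕ.^-monoʳ-< (m * k) 2≤m*k (ℕ.n<1+n (suc k)) ⟩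
  (m * k) ^ (2 + k)                ≤⟨ ℕ.^-monoˡ-≤ (2 + k) (n≤2^⌈log₂n⌉ (m * k)) ⟩
  (2 ^ ⌈log₂ m * k ⌉) ^ (2 + k)    ≡⟨ ℕ.^-*-assoc 2 ⌈log₂ m * k ⌉ (2 + k) ⟩
  2 ^ width k m                    ∎
  where open ℕ.≤-Reasoning

width≤ : ∀ k m → 2 ≤ k → width k m ≤ 2 * (k * ⌈log₂ m * k ⌉)
width≤ k m 2≤k = begin
  ⌈log₂ m * k ⌉ * (2 + k)          ≤⟨ ℕ.*-monoʳ-≤ ⌈log₂ m * k ⌉ (ℕ.+-monoˡ-≤ k 2≤k) ⟩
  ⌈log₂ m * k ⌉ * (k + k)          ≡⟨ rearrange ⌈log₂ m * k ⌉ k ⟩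
  2 * (k * ⌈log₂ m * k ⌉)          ∎
  where
  open ℕ.≤-Reasoning
  rearrange : ∀ l k → l * (k + k) ≡ 2 * (k * l)
  rearrange = solve-∀

-- With m = 0 the bounds leave no memory at all.
memoryless : ∀ passes n → CatalyticStreamingAlgorithm passes n ℕ
memoryless passes n = record
  { cleanBits     = 0
  ; catalyticBits = 0
  ; startPass     = λ μ → μ
  ; readItem      = λ μ _ → μ
  ; endPass       = λ μ → μ
  ; output        = λ _ → 0
  }

powerSumAlgorithm : ∀ k n (m : ℕ) → CatalyticStreamingAlgorithm (suc k) n ℕ
powerSumAlgorithm k n zero      = memoryless (suc k) n
powerSumAlgorithm k n m@(suc _) = PowerSumAlgorithm.algorithm n k (width k m)

powerSumAlgorithm-computes : ∀ k n m → 2 ≤ k → n ≤ m → Computes (powerSumAlgorithm k n m) {m} (F k)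
-- An empty stream forces `n = 0`, so the moment is an empty sum and the constant output 0 is right.
powerSumAlgorithm-computes k .0 zero      2≤k z≤n [] z  = refl , Vec-0-unique _ z
  where
  Vec-0-unique : ∀ (u v : Vec Bool 0) → u ≡ v
  Vec-0-unique [] [] = refl
powerSumAlgorithm-computes k n  m@(suc _) 2≤k n≤m =
  PowerSumAlgorithm.computes n k (width k m)
    (ℕ.≤-<-trans k≤power power<2^width)
    (λ S → ℕ.≤-<-trans (k!*F≤[m*k]^[1+k] k (ℕ.<⇒≤ 2≤k) n≤m S) power<2^width)
  where
  open ℕ.≤-Reasoning
  k≤m*k : k ≤ m * k
  k≤m*k = ℕ.m≤n*m k m
  2≤m*k : 2 ≤ m * k
  2≤m*k = ℕ.≤-trans 2≤k k≤m*k
  power<2^width : (m * k) ^ suc k < 2 ^ width k m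
  power<2^width = [m*k]^[1+k]<2^width k m 2≤m*k
  k≤power : k ≤ (m * k) ^ suc k
  k≤power = begin
    k                  ≤⟨ k≤m*k ⟩
    m * k              ≡⟨ ℕ.*-identityʳ (m * k) ⟨
    (m * k) ^ 1        ≤⟨ ℕ.^-monoʳ-≤ (m * k) {{ℕ.>-nonZero (ℕ.<⇒≤ 2≤m*k)}} (s≤s (z≤n {k})) ⟩
    (m * k) ^ suc k    ∎

cleanBits≤ : ∀ k n m → 2 ≤ k → cleanBits (powerSumAlgorithm k n m) ≤ 4 * (k * ⌈log₂ (m * k) ⌉)
cleanBits≤ k n zero      2≤k = z≤n
cleanBits≤ k n m@(suc _) 2≤k = begin
  2 * width k m                      ≤⟨ ℕ.*-monoʳ-≤ 2 (width≤ k m 2≤k) ⟩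
  2 * (2 * (k * ⌈log₂ (m * k) ⌉))    ≡⟨ ℕ.*-assoc 2 2 (k * ⌈log₂ (m * k) ⌉) ⟨
  4 * (k * ⌈log₂ (m * k) ⌉)          ∎
  where open ℕ.≤-Reasoning

catalyticBits≤ : ∀ k n m → 2 ≤ k →
  catalyticBits (powerSumAlgorithm k n m) ≤ 2 * (k * n * ⌈log₂ (m * k) ⌉)
catalyticBits≤ k n zero      2≤k = z≤n
catalyticBits≤ k n m@(suc _) 2≤k = begin
  n * width k m                      ≤⟨ ℕ.*-monoʳ-≤ n (width≤ k m 2≤k) ⟩
  n * (2 * (k * ⌈log₂ (m * k) ⌉))    ≡⟨ rearrange n k ⌈log₂ (m * k) ⌉ ⟩
  2 * (k * n * ⌈log₂ (m * k) ⌉)      ∎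
  where
  open ℕ.≤-Reasoning
  rearrange : ∀ n k l → n * (2 * (k * l)) ≡ 2 * (k * n * l)
  rearrange = solve-∀

theorem15 : ∃[ C ] ∃[ D ] ((k : ℕ) → 2 ≤ k →
    Σ[ A ∈ ((n m : ℕ) → CatalyticStreamingAlgorithm (suc k) n ℕ) ]
    ((n m : ℕ) → n ≤ m →
    Computes (A n m) {m} (F k)
    × cleanBits (A n m) ≤ C * (k * ⌈log₂ (m * k) ⌉)
    × catalyticBits (A n m) ≤ D * (k * n * ⌈log₂ (m * k) ⌉)))
-- One register has at most `2 * (k * ⌈log₂ (m * k) ⌉)` bits; clean memory holds two of them and
-- catalytic memory one per item.
theorem15 = 4 , 2 , λ k 2≤k → powerSumAlgorithm k , λ n m n≤m →
  powerSumAlgorithm-computes k n m 2≤k n≤m ,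
  cleanBits≤ k n m 2≤k ,
  catalyticBits≤ k n m 2≤k
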